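{- Let $F$ and $G$ be simple graphs. Then \[\hom(F,G^\circ)=\sum_{L\subseteq E(F)}\hom(F\oslash L,G).\]
   Context: Graphs are finite, undirected, without multiple edges, possibly with loops; simple means without loops. A homomorphism $F\to G$ is a vertex map sending edges to edges and looped vertices to looped vertices (so an edge may be mapped onto a loop); $\hom(F,G)$ counts them. $G^\circ$ is obtained from $G$ by adding a loop at every vertex. For a simple graph $F$ and $L\subseteq E(F)$, $v\sim_L w$ iff $v,w$ lie in the same connected component of the graph $(V(F),L)$; $[v]_L$ denotes the class of $v$. The contraction quotient $F\oslash L$ is the graph (possibly with loops) whose vertices are the classes $[v]_L$, with an edge (or loop, if the classes coincide) between $[v]_L$ and $[w]_L$ iff there is an edge $xy\in E(F)\setminus L$ with $x\sim_L v$ and $y\sim_L w$. -}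

module Defs where

open import Data.Fin using (Fin; _≤_)
open import Data.Fin.Properties using (_≟_; _≤?_; all?; any?)
open import Data.Fin.Subset using (Subset; inside; outside; _∈_; ∁)
open import Data.Fin.Subset.Properties using (_∈?_)
open import Data.Bool.Properties using () renaming (_≟_ to _≟ᵇ_)
open import Data.List using (List; []; _∷_; allFin; cartesianProduct; cartesianProductWith; deduplicate; filter; length; lookup; map)
open import Data.List.Membership.Propositional using () renaming (_∈_ to _∈ₗ_)
open import Data.List.Membership.Propositional.Properties using (∈-allFin; ∈-cartesianProduct⁺; ∈-filter⁺; ∈-filter⁻)
open import Data.List.Relation.Unary.Any using (here; there)
open import Data.Nat using (ℕ; zero; suc)
open import Data.Product using (_×_; _,_; ∃-syntax; proj₁; proj₂)
open import Data.Product.Properties using () renaming (≡-dec to ×-≡-dec)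
open import Data.Sum using (_⊎_; inj₁; inj₂; swap)
open import Data.Vec using (Vec; tabulate) renaming ([] to []ᵥ; _∷_ to _∷ᵥ_; lookup to lookupᵥ)
open import Data.Vec.Properties using () renaming (≡-dec to Vec-≡-dec)
open import Level using (0ℓ)
open import Relation.Binary using (Rel; Decidable; Symmetric)
open import Relation.Binary.Construct.Closure.ReflexiveTransitive using (Star; ε; _◅_; _◅◅_) renaming (map to mapStar)
open import Relation.Binary.PropositionalEquality using (_≡_; refl; sym)
open import Relation.Nullary using (¬_; Dec; does; _×-dec_; _⊎-dec_; _→-dec_)
open import Relation.Unary using (Pred)
open import Relation.Nullary.Decidable using (map′)

-- Finite undirected graphs without multiple edges; a loop at v is Adj v v.
record Graph : Set₁ where
  field
    order   : ℕ
    Adj     : Rel (Fin order) 0ℓ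
    adj?    : Decidable Adj
    adj-sym : Symmetric Adj

  Vertex : Set
  Vertex = Fin order

open Graph public

Simple : Graph → Set
Simple G = ∀ v → ¬ Adj G v v

infix 8 _°

_° : Graph → Graph
G ° = record
  { order   = order G
  ; Adj     = λ v w → Adj G v w ⊎ v ≡ w
  ; adj?    = λ v w → adj? G v w ⊎-dec (v ≟ w)
  ; adj-sym = λ { (inj₁ e) → inj₁ (adj-sym G e) ; (inj₂ p) → inj₂ (sym p) }
  }

allVecs : {A : Set} → List A → (n : ℕ) → List (Vec A n)
allVecs xs zero    = []ᵥ ∷ []
allVecs xs (suc n) = cartesianProductWith _∷ᵥ_ xs (allVecs xs n)

-- The case x = y says that looped vertices go to looped vertices.
IsHom : (F G : Graph) → (Vertex F → Vertex G) → Set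
IsHom F G f = ∀ x y → Adj F x y → Adj G (f x) (f y)

isHom? : (F G : Graph) (f : Vertex F → Vertex G) → Dec (IsHom F G f)
isHom? F G f = all? λ x → all? λ y → adj? F x y →-dec adj? G (f x) (f y)

-- A vertex map is represented by the vector of its values, so that each map
-- is counted once without appealing to function extensionality.
hom : Graph → Graph → ℕ
hom F G = length (filter (λ f → isHom? F G (lookupᵥ f)) (allVecs (allFin (order G)) (order F)))

IsEdge : (G : Graph) → Pred (Vertex G × Vertex G) 0ℓ
IsEdge G (v , w) = v ≤ w × Adj G v w

isEdge? : (G : Graph) (p : Vertex G × Vertex G) → Dec (IsEdge G p)
isEdge? G (v , w) = (v ≤? w) ×-dec adj? G v w

-- Each undirected edge is listed once, with its smaller endpoint first.
edges : (G : Graph) → List (Vertex G × Vertex G)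
edges G = filter (isEdge? G) (cartesianProduct (allFin (order G)) (allFin (order G)))

Edge : Graph → Set
Edge G = Fin (length (edges G))

EdgeSet : Graph → Set
EdgeSet G = Subset (length (edges G))

edgeSets : (G : Graph) → List (EdgeSet G)
edgeSets G = allVecs (inside ∷ outside ∷ []) (length (edges G))

Joins : (G : Graph) → Edge G → Rel (Vertex G) 0ℓ
Joins G e v w = lookup (edges G) e ≡ (v , w) ⊎ lookup (edges G) e ≡ (w , v)

-- The graph (V(G), L).
spanning : (G : Graph) → EdgeSet G → Graph
spanning G L = record
  { order   = order G
  ; Adj     = λ v w → ∃[ e ] e ∈ L × Joins G e v w
  ; adj?    = λ v w → any? λ e → (e ∈? L) ×-dec (lookup (edges G) e ≟ₚ (v , w) ⊎-dec lookup (edges G) e ≟ₚ (w , v))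
  ; adj-sym = λ { (e , e∈L , j) → e , e∈L , swap j }
  }
  where _≟ₚ_ = ×-≡-dec _≟_ _≟_

Connected : (G : Graph) → Rel (Vertex G) 0ℓ
Connected G = Star (Adj G)

-- Decidability of connectedness, adding one (directed) edge at a time:
-- a path in (a , b) ∷ es either avoids (a , b), or it starts with a path to a
-- and ends with a path from b, both avoiding (a , b).
module _ {n : ℕ} where

  private
    Step : List (Fin n × Fin n) → Rel (Fin n) 0ℓ
    Step es x y = (x , y) ∈ₗ es

    split : ∀ {a b es x y} → Star (Step ((a , b) ∷ es)) x y →
            Star (Step es) x y ⊎ (Star (Step es) x a × Star (Step es) b y)
    split ε = inj₁ ε
    split (here refl ◅ p) with split p
    ... | inj₁ q       = inj₂ (ε , q)
    ... | inj₂ (_ , r) = inj₂ (ε , r)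
    split (there s ◅ p) with split p
    ... | inj₁ q       = inj₁ (s ◅ q)
    ... | inj₂ (q , r) = inj₂ (s ◅ q , r)

    join : ∀ {a b es x y} →
           Star (Step es) x y ⊎ (Star (Step es) x a × Star (Step es) b y) →
           Star (Step ((a , b) ∷ es)) x y
    join (inj₁ p)       = mapStar there p
    join (inj₂ (p , q)) = mapStar there p ◅◅ here refl ◅ mapStar there q

  starList? : ∀ es → Decidable (Star (Step es))
  starList? []             x y = map′ (λ { refl → ε }) (λ { ε → refl ; (() ◅ _) }) (x ≟ y)
  starList? ((a , b) ∷ es) x y =
    map′ join split (starList? es x y ⊎-dec (starList? es x a ×-dec starList? es b y))

connected? : (G : Graph) → Decidable (Connected G)
connected? G x y = map′ (mapStar to) (mapStar from) (starList? arcs x y)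
  where
  pairs : List (Vertex G × Vertex G)
  pairs = cartesianProduct (allFin (order G)) (allFin (order G))

  isArc? : (p : Vertex G × Vertex G) → Dec (Adj G (proj₁ p) (proj₂ p))
  isArc? (v , w) = adj? G v w

  arcs : List (Vertex G × Vertex G)
  arcs = filter isArc? pairs

  to : ∀ {v w} → (v , w) ∈ₗ arcs → Adj G v w
  to v,w∈arcs = proj₂ (∈-filter⁻ isArc? {xs = pairs} v,w∈arcs)

  from : ∀ {v w} → Adj G v w → (v , w) ∈ₗ arcs
  from {v} {w} e = ∈-filter⁺ isArc? (∈-cartesianProduct⁺ (∈-allFin v) (∈-allFin w)) e

module _ (F : Graph) (L : EdgeSet F) where

  -- [ v ]_L, as a set of vertices.
  class : Vertex F → Subset (order F)
  class v = tabulate λ w → does (connected? (spanning F L) v w)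

  classes : List (Subset (order F))
  classes = deduplicate (Vec-≡-dec _≟ᵇ_) (map class (allFin (order F)))

infix 8 _⊘_

-- The vertices are the distinct classes, numbered by their position in
-- `classes`; spanning F (∁ L) is the graph (V(F), E(F) ∖ L).
_⊘_ : (F : Graph) → EdgeSet F → Graph
F ⊘ L = record
  { order   = length (classes F L)
  ; Adj     = λ p q → ∃[ x ] ∃[ y ] Adj F∖L x y × x ∈ lookup (classes F L) p × y ∈ lookup (classes F L) q
  ; adj?    = λ p q → any? λ x → any? λ y →
                adj? F∖L x y ×-dec (x ∈? lookup (classes F L) p) ×-dec (y ∈? lookup (classes F L) q)
  ; adj-sym = λ { (x , y , e , x∈p , y∈q) → y , x , adj-sym F∖L {x} {y} e , y∈q , x∈p }
  }
  where
  F∖L : Graph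
  F∖L = spanning F (∁ L)

{-# OPTIONS --safe #-}

-- A homomorphism f : F → G° determines the set L of edges of F on whose two
-- ends f agrees. It is constant on the components of (V(F), L), and the map it
-- induces on F ⊘ L is a homomorphism to G. Conversely, composing a homomorphism
-- F ⊘ L → G with the quotient map gives a homomorphism F → G° which identifies
-- the ends of the edges in L, and of no others because G has no loops. Hence the
-- homomorphisms F → G° are partitioned, according to L, into copies of the sets
-- of homomorphisms F ⊘ L → G.
module Submission where

open import Defs
open import Data.Bool.Properties using () renaming (_≟_ to _≟ᵇ_)
open import Data.Fin using (Fin; zero; suc)
open import Data.Fin.Properties using (_≟_; ≤-total)
open import Data.Fin.Subset using (Subset; inside; outside; _∈_; ∁)
open import Data.Fin.Subset.Properties using (_∈?_; ⊆-antisym; x∈∁p⇒x∉p; x∉p⇒x∈∁p)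
open import Data.List using (List; []; _∷_; map; filter; length; lookup; concat; allFin; cartesianProduct)
open import Data.List.Properties using (length-map; length-++)
open import Data.List.Membership.Propositional using () renaming (_∈_ to _∈ₗ_)
open import Data.List.Membership.Propositional.Properties
  using (∈-allFin; ∈-cartesianProduct⁺; ∈-cartesianProductWith⁺; ∈-filter⁺; ∈-filter⁻; ∈-map⁺; ∈-map⁻;
         ∈-concat⁺′; ∈-concat⁻′; ∈-deduplicate⁺; ∈-deduplicate⁻; ∈-lookup)
open import Data.List.Membership.Propositional.Properties.WithK using (unique∧set⇒bag)
open import Data.List.Relation.Binary.BagAndSetEquality using (∼bag⇒↭)
open import Data.List.Relation.Binary.Disjoint.Propositional using (Disjoint)
open import Data.List.Relation.Binary.Permutation.Propositional.Properties using (↭-length)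
open import Data.List.Relation.Unary.All as All using ()
import Data.List.Relation.Unary.All.Properties as All
open import Data.List.Relation.Unary.AllPairs as AllPairs using ([]; _∷_)
import Data.List.Relation.Unary.AllPairs.Properties as AllPairs
open import Data.List.Relation.Unary.Any using (here; there; index)
open import Data.List.Relation.Unary.Any.Properties using (lookup-index)
open import Data.List.Relation.Unary.Unique.Propositional using (Unique)
open import Data.List.Relation.Unary.Unique.Propositional.Properties as Unique using (allFin⁺)
open import Data.List.Relation.Unary.Unique.DecPropositional.Properties using (deduplicate-!)
open import Data.Nat using (ℕ; zero; suc; _+_)
open import Data.Nat.ListAction using (sum)
open import Data.Product using (_×_; _,_; ∃-syntax; proj₁; proj₂)
open import Data.Sum using (inj₁; inj₂)
open import Data.Vec using (Vec; tabulate) renaming ([] to []ᵥ; _∷_ to _∷ᵥ_; lookup to lookupᵥ)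
open import Data.Vec.Properties as Vec
  using (lookup∘tabulate; tabulate∘lookup; tabulate-cong; []=⇒lookup; lookup⇒[]=)
open import Function using (_∘_; mk⇔)
open import Relation.Binary.Construct.Closure.ReflexiveTransitive
  using (ε; _◅_; _◅◅_; fold; return; reverse)
open import Relation.Binary.PropositionalEquality
  using (_≡_; _≢_; refl; sym; trans; cong; cong₂; subst; subst₂; module ≡-Reasoning)
open import Relation.Nullary using (¬_; Dec; yes; no; does; contradiction)
open import Relation.Nullary.Decidable using (dec-true; does-⇔)

-- Duplicate-free lists, vectors and tabulated subsets.

private
  variable
    A : Set
    n : ℕ

length-concat : (xss : List (List A)) → length (concat xss) ≡ sum (map length xss)
length-concat []         = refl
length-concat (xs ∷ xss) = trans (length-++ xs) (cong (length xs +_) (length-concat xss))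

-- Homomorphisms are counted by list length, so this reduces the theorem to two inclusions:
-- duplicate-free lists with the same members are permutations of each other.
unique∧set⇒length≡ : {xs ys : List A} → Unique xs → Unique ys →
  (∀ {x} → x ∈ₗ xs → x ∈ₗ ys) → (∀ {x} → x ∈ₗ ys → x ∈ₗ xs) → length xs ≡ length ys
unique∧set⇒length≡ xs! ys! xs⊆ys ys⊆xs =
  ↭-length (∼bag⇒↭ (unique∧set⇒bag xs! ys! (mk⇔ xs⊆ys ys⊆xs)))

lookup-injective : {xs : List A} → Unique xs → ∀ i j → lookup xs i ≡ lookup xs j → i ≡ j
lookup-injective (_ ∷ _)    zero    zero    _  = refl
lookup-injective (x∉xs ∷ _) zero    (suc j) eq = contradiction eq (All.lookup x∉xs (∈-lookup j))
lookup-injective (x∉xs ∷ _) (suc i) zero    eq = contradiction (sym eq) (All.lookup x∉xs (∈-lookup i))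
lookup-injective (_ ∷ xs!)  (suc i) (suc j) eq = cong suc (lookup-injective xs! i j eq)

lookup-extensional : {xs ys : Vec A n} → (∀ i → lookupᵥ xs i ≡ lookupᵥ ys i) → xs ≡ ys
lookup-extensional {xs = xs} {ys} eq =
  trans (sym (tabulate∘lookup xs)) (trans (tabulate-cong eq) (tabulate∘lookup ys))

∈-allVecs⁺ : {xs : List A} (v : Vec A n) → (∀ i → lookupᵥ v i ∈ₗ xs) → v ∈ₗ allVecs xs n
∈-allVecs⁺ []ᵥ      _   = here refl
∈-allVecs⁺ (x ∷ᵥ v) v∈ = ∈-cartesianProductWith⁺ _∷ᵥ_ (v∈ zero) (∈-allVecs⁺ v (v∈ ∘ suc))

allVecs⁺ : {xs : List A} → Unique xs → ∀ n → Unique (allVecs xs n)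
allVecs⁺ xs! zero    = All.[] ∷ []
allVecs⁺ xs! (suc n) = Unique.cartesianProductWith⁺ _∷ᵥ_ Vec.∷-injective xs! (allVecs⁺ xs! n)

module _ {P : Fin n → Set} (P? : ∀ i → Dec (P i)) where

  ∈-tabulate⁺ : ∀ {i} → P i → i ∈ tabulate (does ∘ P?)
  ∈-tabulate⁺ {i} Pi =
    lookup⇒[]= i _ (trans (lookup∘tabulate (does ∘ P?) i) (dec-true (P? i) Pi))

  ∈-tabulate⁻ : ∀ {i} → i ∈ tabulate (does ∘ P?) → P i
  ∈-tabulate⁻ {i} i∈ with P? i | trans (sym (lookup∘tabulate (does ∘ P?) i)) ([]=⇒lookup i∈)
  ... | yes Pi | _  = Pi
  ... | no _   | ()

-- Edges and the edges identified by a vertex map.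

module _ (F : Graph) where

  edge-joins : ∀ e → Joins F e (proj₁ (lookup (edges F) e)) (proj₂ (lookup (edges F) e))
  edge-joins e = inj₁ refl

  private
    pairs : List (Vertex F × Vertex F)
    pairs = cartesianProduct (allFin (order F)) (allFin (order F))

  -- The list `edges` stores the smaller endpoint first, so the order of `x` and `y` decides the
  -- orientation in which the edge is found.
  Adj⇒Joins : ∀ {x y} → Adj F x y → ∃[ e ] Joins F e x y
  Adj⇒Joins {x} {y} xy with ≤-total x y
  ... | inj₁ x≤y = index xy∈ , inj₁ (sym (lookup-index xy∈))
    where xy∈ = ∈-filter⁺ (isEdge? F) (∈-cartesianProduct⁺ (∈-allFin x) (∈-allFin y)) (x≤y , xy)
  ... | inj₂ y≤x = index yx∈ , inj₂ (sym (lookup-index yx∈))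
    where yx∈ = ∈-filter⁺ (isEdge? F) (∈-cartesianProduct⁺ (∈-allFin y) (∈-allFin x)) (y≤x , adj-sym F xy)

  Joins⇒Adj : ∀ {e x y} → Joins F e x y → Adj F x y
  Joins⇒Adj {e} j with proj₂ (∈-filter⁻ (isEdge? F) {xs = pairs} (∈-lookup {xs = edges F} e)) | j
  ... | _ , xy | inj₁ eq = subst (λ p → Adj F (proj₁ p) (proj₂ p)) eq xy
  ... | _ , yx | inj₂ eq = adj-sym F (subst (λ p → Adj F (proj₁ p) (proj₂ p)) eq yx)

  -- Referring only to the stored orientation makes this a single equation per edge; `identifies⁺`
  -- and `identifies⁻` carry it to either orientation.
  Identifies : (Vertex F → A) → Edge F → Set
  Identifies f e = f (proj₁ (lookup (edges F) e)) ≡ f (proj₂ (lookup (edges F) e))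

  identifies⁺ : (f : Vertex F → A) → ∀ {e x y} → Joins F e x y → f x ≡ f y → Identifies f e
  identifies⁺ f (inj₁ eq) fx≡fy = subst (λ p → f (proj₁ p) ≡ f (proj₂ p)) (sym eq) fx≡fy
  identifies⁺ f (inj₂ eq) fx≡fy = subst (λ p → f (proj₁ p) ≡ f (proj₂ p)) (sym eq) (sym fx≡fy)

  identifies⁻ : (f : Vertex F → A) → ∀ {e x y} → Joins F e x y → Identifies f e → f x ≡ f y
  identifies⁻ f (inj₁ eq) fe = subst (λ p → f (proj₁ p) ≡ f (proj₂ p)) eq fe
  identifies⁻ f (inj₂ eq) fe = sym (subst (λ p → f (proj₁ p) ≡ f (proj₂ p)) eq fe)

-- Enumeration of edge sets and homomorphisms.

∈-edgeSets : (F : Graph) (L : EdgeSet F) → L ∈ₗ edgeSets F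
∈-edgeSets F L = ∈-allVecs⁺ L λ e → bool (lookupᵥ L e)
  where
  bool : ∀ b → b ∈ₗ inside ∷ outside ∷ []
  bool inside  = here refl
  bool outside = there (here refl)

edgeSets-unique : (F : Graph) → Unique (edgeSets F)
edgeSets-unique F = allVecs⁺ (((λ ()) All.∷ All.[]) ∷ All.[] ∷ []) _

-- The list whose length is, by definition, `hom F G`.
homs : (F G : Graph) → List (Vec (Vertex G) (order F))
homs F G = filter (λ f → isHom? F G (lookupᵥ f)) (allVecs (allFin (order G)) (order F))

module _ (F G : Graph) where

  homs-unique : Unique (homs F G)
  homs-unique = Unique.filter⁺ (λ f → isHom? F G (lookupᵥ f)) (allVecs⁺ (allFin⁺ (order G)) (order F))

  ∈-homs⁺ : ∀ f → IsHom F G (lookupᵥ f) → f ∈ₗ homs F G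
  ∈-homs⁺ f hom-f =
    ∈-filter⁺ (λ f → isHom? F G (lookupᵥ f)) (∈-allVecs⁺ f λ x → ∈-allFin (lookupᵥ f x)) hom-f

  ∈-homs⁻ : ∀ f → f ∈ₗ homs F G → IsHom F G (lookupᵥ f)
  ∈-homs⁻ f f∈ =
    proj₂ (∈-filter⁻ (λ f → isHom? F G (lookupᵥ f)) {xs = allVecs (allFin (order G)) (order F)} f∈)

-- The quotient map and pulling back along it.

module Quotient (F : Graph) (L : EdgeSet F) where

  private
    _∼_ = Connected (spanning F L)
    _∼?_ = connected? (spanning F L)

  ∼-sym : ∀ {v w} → v ∼ w → w ∼ v
  ∼-sym = reverse (adj-sym (spanning F L))

  -- Prefixing the path between `v` and `w`, in one direction or the other, shows that each `x` is
  -- reachable from both or from neither, so the Boolean vectors agree entrywise.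
  ∼⇒class≡ : ∀ {v w} → v ∼ w → class F L v ≡ class F L w
  ∼⇒class≡ {v} {w} v∼w =
    tabulate-cong λ x → does-⇔ (mk⇔ (∼-sym v∼w ◅◅_) (v∼w ◅◅_)) (v ∼? x) (w ∼? x)

  class∈classes : ∀ v → class F L v ∈ₗ classes F L
  class∈classes v = ∈-deduplicate⁺ (Vec.≡-dec _≟ᵇ_) (∈-map⁺ (class F L) (∈-allFin v))

  -- The quotient map.
  [_] : Vertex F → Vertex (F ⊘ L)
  [ v ] = index (class∈classes v)

  lookup-[] : ∀ v → lookup (classes F L) [ v ] ≡ class F L v
  lookup-[] v = sym (lookup-index (class∈classes v))

  -- After deduplication an entry of `classes` determines its position.
  lookup≡class⇒[] : ∀ {p v} → lookup (classes F L) p ≡ class F L v → p ≡ [ v ]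
  lookup≡class⇒[] {p} {v} eq = lookup-injective
    (deduplicate-! (Vec.≡-dec _≟ᵇ_) (map (class F L) (allFin (order F))))
    p [ v ] (trans eq (sym (lookup-[] v)))

  -- Surjectivity of the quotient map, with a chosen representative: each entry of `classes` arose
  -- as the class of some vertex.
  rep : ∀ p → ∃[ v ] p ≡ [ v ]
  rep p with ∈-map⁻ (class F L)
               (∈-deduplicate⁻ (Vec.≡-dec _≟ᵇ_) (map (class F L) (allFin (order F))) (∈-lookup p))
  ... | v , _ , eq = v , lookup≡class⇒[] eq

  ∼⇒[]≡ : ∀ {v w} → v ∼ w → [ v ] ≡ [ w ]
  ∼⇒[]≡ {v} v∼w = lookup≡class⇒[] (trans (lookup-[] v) (∼⇒class≡ v∼w))

  ∈-[]⁺ : ∀ v → v ∈ lookup (classes F L) [ v ]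
  ∈-[]⁺ v = subst (v ∈_) (sym (lookup-[] v)) (∈-tabulate⁺ (v ∼?_) ε)

  ∈-[]⁻ : ∀ {v x} → x ∈ lookup (classes F L) [ v ] → v ∼ x
  ∈-[]⁻ {v} {x} x∈ = ∈-tabulate⁻ (v ∼?_) (subst (x ∈_) (lookup-[] v) x∈)

  pullback : Vec A (order (F ⊘ L)) → Vec A (order F)
  pullback g = tabulate λ v → lookupᵥ g [ v ]

  lookup-pullback : (g : Vec A (order (F ⊘ L))) → ∀ v → lookupᵥ (pullback g) v ≡ lookupᵥ g [ v ]
  lookup-pullback g = lookup∘tabulate λ v → lookupᵥ g [ v ]

  -- The quotient map is onto, so every value of `g` occurs as a value of its pullback.
  pullback-injective : {g h : Vec A (order (F ⊘ L))} → pullback g ≡ pullback h → g ≡ h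
  pullback-injective {g = g} {h} eq = lookup-extensional λ p → lemma p (rep p)
    where
    lemma : ∀ p → ∃[ v ] p ≡ [ v ] → lookupᵥ g p ≡ lookupᵥ h p
    lemma _ (v , refl) = begin
      lookupᵥ g [ v ]         ≡⟨ lookup-pullback g v ⟨
      lookupᵥ (pullback g) v  ≡⟨ cong (λ f → lookupᵥ f v) eq ⟩
      lookupᵥ (pullback h) v  ≡⟨ lookup-pullback h v ⟩
      lookupᵥ h [ v ]         ∎
      where open ≡-Reasoning

  -- Agreement along single edges of `L` spreads along paths to whole components, so `g` can read
  -- off `f` at the representative of each class.
  pullback-surjective : (f : Vec A (order F)) →
    (∀ {e x y} → e ∈ L → Joins F e x y → lookupᵥ f x ≡ lookupᵥ f y) → ∃[ g ] f ≡ pullback g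
  pullback-surjective f f-const = g , lookup-extensional λ v → begin
      lookupᵥ f v                       ≡⟨ ∼-const (∼-rep v) ⟩
      lookupᵥ f (proj₁ (rep [ v ]))     ≡⟨ lookup∘tabulate (λ p → lookupᵥ f (proj₁ (rep p))) [ v ] ⟨
      lookupᵥ g [ v ]                   ≡⟨ lookup-pullback g v ⟨
      lookupᵥ (pullback g) v            ∎
    where
    open ≡-Reasoning
    g = tabulate λ p → lookupᵥ f (proj₁ (rep p))

    ∼-const : ∀ {x y} → x ∼ y → lookupᵥ f x ≡ lookupᵥ f y
    ∼-const = fold (λ x y → lookupᵥ f x ≡ lookupᵥ f y) (λ (_ , e∈L , j) → trans (f-const e∈L j)) refl

    -- The representative may differ from `v`, but its class has position `[ v ]`, so it lies in the
    -- class of `v`.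
    ∼-rep : ∀ v → v ∼ proj₁ (rep [ v ])
    ∼-rep v = ∈-[]⁻ (subst (λ p → proj₁ (rep [ v ]) ∈ lookup (classes F L) p)
                           (sym (proj₂ (rep [ v ]))) (∈-[]⁺ _))

  joins⇒[]≡ : ∀ {e x y} → e ∈ L → Joins F e x y → [ x ] ≡ [ y ]
  joins⇒[]≡ {e} e∈L j = ∼⇒[]≡ (return (e , e∈L , j))

  joins⇒[]Adj : ∀ {e x y} → ¬ e ∈ L → Joins F e x y → Adj (F ⊘ L) [ x ] [ y ]
  joins⇒[]Adj {e} {x} {y} e∉L j = x , y , (e , x∉p⇒x∈∁p e∉L , j) , ∈-[]⁺ x , ∈-[]⁺ y

  pullback-const : (g : Vec A (order (F ⊘ L))) →
    ∀ {e x y} → e ∈ L → Joins F e x y → lookupᵥ (pullback g) x ≡ lookupᵥ (pullback g) y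
  pullback-const g {x = x} {y} e∈L j =
    trans (lookup-pullback g x) (trans (cong (lookupᵥ g) (joins⇒[]≡ e∈L j)) (sym (lookup-pullback g y)))

  module _ (G : Graph) (g : Vec (Vertex G) (order (F ⊘ L))) where

    pullback-adj : IsHom (F ⊘ L) G (lookupᵥ g) → ∀ {e x y} → ¬ e ∈ L → Joins F e x y →
      Adj G (lookupᵥ (pullback g) x) (lookupᵥ (pullback g) y)
    pullback-adj hom-g {x = x} {y} e∉L j =
      subst₂ (Adj G) (sym (lookup-pullback g x)) (sym (lookup-pullback g y))
        (hom-g _ _ (joins⇒[]Adj e∉L j))

    -- Edges in `L` collapse onto the added loops of `G °`; all others pass through edges of `F ⊘ L`
    -- to edges of `G`.
    pullback-hom⁺ : IsHom (F ⊘ L) G (lookupᵥ g) → IsHom F (G °) (lookupᵥ (pullback g))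
    pullback-hom⁺ hom-g x y xy with Adj⇒Joins F xy
    ... | e , j with e ∈? L
    ...   | yes e∈L = inj₂ (pullback-const g e∈L j)
    ...   | no  e∉L = inj₁ (pullback-adj hom-g e∉L j)

    -- An edge of `F ⊘ L` comes from an edge of `F` outside `L`. The pullback does not identify its
    -- ends, so its image is an edge of `G` and not an added loop.
    pullback-hom⁻ : IsHom F (G °) (lookupᵥ (pullback g)) →
      (∀ {e} → Identifies F (lookupᵥ (pullback g)) e → e ∈ L) → IsHom (F ⊘ L) G (lookupᵥ g)
    pullback-hom⁻ hom-f identifies⇒∈L p q (x , y , (e , e∈∁L , j) , x∈p , y∈q)
      with rep p | rep q
    ... | v , refl | w , refl with hom-f x y (Joins⇒Adj F j)
    ...   | inj₂ fx≡fy =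
      contradiction (identifies⇒∈L (identifies⁺ F (lookupᵥ (pullback g)) j fx≡fy)) (x∈∁p⇒x∉p e∈∁L)
    ...   | inj₁ fxfy = subst₂ (Adj G) (value x∈p) (value y∈q) fxfy
      where
      -- The ends `x` and `y` are arbitrary members of their classes, but the pullback is constant
      -- on each class.
      value : ∀ {u z} → z ∈ lookup (classes F L) [ u ] → lookupᵥ (pullback g) z ≡ lookupᵥ g [ u ]
      value {z = z} z∈ = trans (lookup-pullback g z) (cong (lookupᵥ g) (sym (∼⇒[]≡ (∈-[]⁻ z∈))))

  -- An identified edge outside `L` would be sent to a loop of `G`.
  pullback-identifies⇒∈ : (G : Graph) → Simple G → (g : Vec (Vertex G) (order (F ⊘ L))) →
    IsHom (F ⊘ L) G (lookupᵥ g) → ∀ {e} → Identifies F (lookupᵥ (pullback g)) e → e ∈ L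
  pullback-identifies⇒∈ G G-simple g hom-g {e} fe with e ∈? L
  ... | yes e∈L = e∈L
  ... | no  e∉L = contradiction
    (subst (Adj G _) (sym fe) (pullback-adj G g hom-g e∉L (edge-joins F e))) (G-simple _)

-- Partition of the homomorphisms to `G °` by edge sets.

open Quotient using (pullback)

module _ (F G : Graph) (G-simple : Simple G) where

  pulledBack : EdgeSet F → List (Vec (Vertex G) (order F))
  pulledBack L = map (pullback F L) (homs (F ⊘ L) G)

  -- This recovers `L` from `f` alone, which makes the blocks for distinct edge sets disjoint.
  pulledBack-∈⇔identifies : ∀ {L f} → f ∈ₗ pulledBack L →
    ∀ {e} → (e ∈ L → Identifies F (lookupᵥ f) e) × (Identifies F (lookupᵥ f) e → e ∈ L)
  pulledBack-∈⇔identifies {L} f∈ {e} with ∈-map⁻ (pullback F L) f∈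
  ... | g , g∈ , refl =
    (λ e∈L → Quotient.pullback-const F L g e∈L (edge-joins F e)) ,
    Quotient.pullback-identifies⇒∈ F L G G-simple g (∈-homs⁻ (F ⊘ L) G g g∈)

  pulledBack-disjoint : ∀ {L M} → L ≢ M → Disjoint (pulledBack L) (pulledBack M)
  pulledBack-disjoint L≢M (f∈L , f∈M) = L≢M (⊆-antisym
    (proj₂ (pulledBack-∈⇔identifies f∈M) ∘ proj₁ (pulledBack-∈⇔identifies f∈L))
    (proj₂ (pulledBack-∈⇔identifies f∈L) ∘ proj₁ (pulledBack-∈⇔identifies f∈M)))

  allPulledBack : List (Vec (Vertex G) (order F))
  allPulledBack = concat (map pulledBack (edgeSets F))

  allPulledBack-unique : Unique allPulledBack
  allPulledBack-unique = Unique.concat⁺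
    (All.map⁺ (All.tabulate λ {L} _ →
      Unique.map⁺ (Quotient.pullback-injective F L) (homs-unique (F ⊘ L) G)))
    (AllPairs.map⁺ (AllPairs.map pulledBack-disjoint (edgeSets-unique F)))

  homs°⊆allPulledBack : ∀ {f} → f ∈ₗ homs F (G °) → f ∈ₗ allPulledBack
  homs°⊆allPulledBack {f} f∈ = lemma (Quotient.pullback-surjective F L f f-const)
    where
    identifies? : ∀ e → Dec (Identifies F (lookupᵥ f) e)
    identifies? e = _ ≟ _

    -- By `pulledBack-∈⇔identifies`, this is the only edge set whose block can contain `f`.
    L : EdgeSet F
    L = tabulate (does ∘ identifies?)

    f-const : ∀ {e x y} → e ∈ L → Joins F e x y → lookupᵥ f x ≡ lookupᵥ f y
    f-const e∈L j = identifies⁻ F (lookupᵥ f) j (∈-tabulate⁻ identifies? e∈L)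

    lemma : ∃[ g ] f ≡ pullback F L g → f ∈ₗ allPulledBack
    lemma (g , f≡) = ∈-concat⁺′
      (subst (_∈ₗ pulledBack L) (sym f≡) (∈-map⁺ (pullback F L) (∈-homs⁺ (F ⊘ L) G g
        (Quotient.pullback-hom⁻ F L G g
          (subst (IsHom F (G °) ∘ lookupᵥ) f≡ (∈-homs⁻ F (G °) f f∈))
          λ {e} ge → ∈-tabulate⁺ identifies? (subst (λ h → Identifies F (lookupᵥ h) e) (sym f≡) ge)))))
      (∈-map⁺ pulledBack (∈-edgeSets F L))

  allPulledBack⊆homs° : ∀ {f} → f ∈ₗ allPulledBack → f ∈ₗ homs F (G °)
  allPulledBack⊆homs° f∈ with ∈-concat⁻′ (map pulledBack (edgeSets F)) f∈
  ... | _ , f∈fs , fs∈ with ∈-map⁻ pulledBack fs∈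
  ...   | L , _ , refl with ∈-map⁻ (pullback F L) f∈fs
  ...     | g , g∈ , refl =
    ∈-homs⁺ F (G °) (pullback F L g) (Quotient.pullback-hom⁺ F L G g (∈-homs⁻ (F ⊘ L) G g g∈))

  -- Mapping preserves the length of each block; that nothing is counted twice is the content of
  -- `allPulledBack-unique`.
  length-allPulledBack : length allPulledBack ≡ sum (map (λ L → hom (F ⊘ L) G) (edgeSets F))
  length-allPulledBack = trans (length-concat (map pulledBack (edgeSets F))) (cong sum (lengths (edgeSets F)))
    where
    lengths : ∀ Ls → map length (map pulledBack Ls) ≡ map (λ L → hom (F ⊘ L) G) Ls
    lengths []       = refl
    lengths (L ∷ Ls) = cong₂ _∷_ (length-map (pullback F L) (homs (F ⊘ L) G)) (lengths Ls)

theorem10 : (F G : Graph) → Simple F → Simple G →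
    hom F (G °) ≡ sum (map (λ L → hom (F ⊘ L) G) (edgeSets F))
theorem10 F G _ G-simple = trans
  (unique∧set⇒length≡ (homs-unique F (G °)) (allPulledBack-unique F G G-simple)
    (homs°⊆allPulledBack F G G-simple) (allPulledBack⊆homs° F G G-simple))
  (length-allPulledBack F G G-simple)
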